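{- Let $A=\omega_1^*+\omega_1$. There exist linear orders $X$ and $Y$ with $X\not\cong Y$ such that \[ X\cong A\times Y,\qquad X\cong Y\times\omega,\qquad Y\cong A\times X,\qquad Y\cong X\times\omega . \] In particular, there exist two non-isomorphic linear orders each of which is both a left-hand divisor and a right-hand divisor of the other.
   Context: For linear orders $X,Y$, the lexicographical product $X\times Y$ is the set $\{(x,y):x\in X,\ y\in Y\}$ ordered lexicographically (first by $x$, then by $y$); equivalently, it is the order obtained from $X$ by replacing each point of $X$ with a copy of $Y$. For linear orders $X$ and $Y$, $X+Y$ denotes a copy of $X$ followed by a copy of $Y$, and $X^*$ denotes the reverse of $X$. $\omega$ is the order type of the natural numbers and $\omega_1$ is the first uncountable ordinal, so $A=\omega_1^*+\omega_1$ is the reverse of $\omega_1$ followed by $\omega_1$. An order $Z$ is a left-hand divisor of $W$ if $W\cong Z\times B$ for some order $B$, and a right-hand divisor of $W$ if $W\cong B\times Z$ for some order $B$. -}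

module Defs where

open import Axiom.ExcludedMiddle using (ExcludedMiddle)
open import Data.Empty using (⊥; ⊥-elim)
open import Data.Nat.Base as ℕ using (ℕ; zero; suc)
import Data.Nat.Properties as ℕₚ
open import Data.Nat.Induction using (<-rec)
open import Data.Product.Base using (Σ; ∃; _×_; _,_; proj₁; proj₂; uncurry)
open import Data.Product.Relation.Binary.Lex.Strict using (×-strictTotalOrder)
open import Data.Sum.Base using (_⊎_; inj₁; inj₂)
open import Data.Sum.Relation.Binary.LeftOrder using (⊎-<-strictTotalOrder)
open import Data.Unit.Base using (⊤; tt)
open import Function.Bundles using (Injection)
open import Induction.WellFounded using (WellFounded; Acc; acc)
open import Level using (0ℓ)
open import Relation.Binary.Bundles using (Setoid; StrictTotalOrder)
import Relation.Binary.Construct.Flip.EqAndOrd as Flip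
import Relation.Binary.Construct.On as On
open import Relation.Binary.Definitions using (Trichotomous; tri<; tri≈; tri>)
open import Relation.Binary.Morphism.Structures using (IsOrderIsomorphism)
open import Relation.Binary.PropositionalEquality
  using (_≡_; refl; sym; trans; subst; setoid)
open import Relation.Nullary using (¬_; yes; no)

LinearOrder : Set₁
LinearOrder = StrictTotalOrder 0ℓ 0ℓ 0ℓ

infix  4 _≅_
infixl 7 _⊗_
infixl 6 _⊕_
infix  8 _*

-- For strict total orders the order-reflecting part of IsOrderIsomorphism
-- is automatic, so this is the usual notion of order isomorphism.
_≅_ : LinearOrder → LinearOrder → Set
X ≅ Y = ∃ λ (f : X.Carrier → Y.Carrier) →
          IsOrderIsomorphism X._≈_ Y._≈_ X._<_ Y._<_ f
  where
  module X = StrictTotalOrder X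
  module Y = StrictTotalOrder Y

-- The left factor is the more significant one: X ⊗ Y replaces every point
-- of X by a copy of Y.
_⊗_ : LinearOrder → LinearOrder → LinearOrder
_⊗_ = ×-strictTotalOrder

_⊕_ : LinearOrder → LinearOrder → LinearOrder
_⊕_ = ⊎-<-strictTotalOrder {d = 0ℓ} {e = 0ℓ} {f = 0ℓ}

_* : LinearOrder → LinearOrder
X * = Flip.strictTotalOrder X

ω : LinearOrder
ω = ℕₚ.<-strictTotalOrder

LeftDivisor : LinearOrder → LinearOrder → Set₁
LeftDivisor Z W = ∃ λ (B : LinearOrder) → W ≅ Z ⊗ B

RightDivisor : LinearOrder → LinearOrder → Set₁
RightDivisor Z W = ∃ λ (B : LinearOrder) → W ≅ B ⊗ Z

Countable : Setoid 0ℓ 0ℓ → Set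
Countable S = Injection S (setoid ℕ)

pointSetoid : LinearOrder → Setoid 0ℓ 0ℓ
pointSetoid X = StrictTotalOrder.Eq.setoid X

segment : (X : LinearOrder) → StrictTotalOrder.Carrier X → Setoid 0ℓ 0ℓ
segment X x = On.setoid (pointSetoid X) (proj₁ {A = X.Carrier} {B = X._< x})
  where module X = StrictTotalOrder X

-- The first uncountable ordinal: an uncountable well-order such that all
-- smaller ordinals, i.e. all its proper initial segments, are countable.
record IsFirstUncountableOrdinal (Ω : LinearOrder) : Set where
  open StrictTotalOrder Ω using (Carrier; _<_)
  field
    wellFounded : WellFounded _<_
    uncountable : ¬ Countable (pointSetoid Ω)
    first       : (α : Carrier) → Countable (segment Ω α)

-- The remainder shows that, classically, such an order exists, so that
-- quantifying over all of them is not vacuous.  The witness consists of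
-- countably branching trees; sup f denotes the least ordinal strictly
-- above every f n.
private
  data Tree : Set where
    nil : Tree
    sup : (ℕ → Tree) → Tree

  _≤_ : Tree → Tree → Set
  nil   ≤ t     = ⊤
  sup f ≤ nil   = ⊥
  sup f ≤ sup g = ∀ n → ∃ λ m → f n ≤ g m

  _<_ : Tree → Tree → Set
  s < nil   = ⊥
  s < sup g = ∃ λ m → s ≤ g m

  _≈_ : Tree → Tree → Set
  s ≈ t = s ≤ t × t ≤ s

  ≤-refl : ∀ t → t ≤ t
  ≤-refl nil     = tt
  ≤-refl (sup f) = λ n → n , ≤-refl (f n)

  ≤-trans : ∀ r s t → r ≤ s → s ≤ t → r ≤ t
  ≤-trans nil     s       t       p q = tt
  ≤-trans (sup f) (sup g) (sup h) p q n =
    let (m , a) = p n ; (k , b) = q m in k , ≤-trans (f n) (g m) (h k) a b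

  ≤-<-trans : ∀ r s t → r ≤ s → s < t → r < t
  ≤-<-trans r s (sup h) p (m , q) = m , ≤-trans r s (h m) p q

  <-≤-trans : ∀ r s t → r < s → s ≤ t → r < t
  <-≤-trans r (sup g) (sup h) (m , p) q =
    let (k , b) = q m in k , ≤-trans r (g m) (h k) p b

  sup-least : ∀ f t → (∀ n → f n < t) → sup f ≤ t
  sup-least f nil     p = p 0
  sup-least f (sup g) p = p

  <⇒≤ : ∀ s t → s < t → s ≤ t
  <⇒≤ nil     t       p       = tt
  <⇒≤ (sup f) (sup g) (m , p) n =
    m , <⇒≤ (f n) (g m) (<-≤-trans (f n) (sup f) (g m) (n , ≤-refl (f n)) p)

  <-trans : ∀ r s t → r < s → s < t → r < t
  <-trans r s t p q = ≤-<-trans r s t (<⇒≤ r s p) q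

  ≤⇒Acc : ∀ t s → s ≤ t → Acc _<_ s
  ≤⇒Acc t s p = acc λ {r} q → below t r (<-≤-trans r s t q p)
    where
    below : ∀ t r → r < t → Acc _<_ r
    below (sup g) r (m , q) = ≤⇒Acc (g m) r q

  <-wf : WellFounded _<_
  <-wf t = ≤⇒Acc t t (≤-refl t)

  <-irrefl : ∀ t → ¬ (t < t)
  <-irrefl t p = go (<-wf t) p
    where
    go : ∀ {t} → Acc _<_ t → ¬ (t < t)
    go (acc h) q = go (h q) q

  step : ℕ × ℕ → ℕ × ℕ
  step (zero  , b) = suc b , 0
  step (suc a , b) = a , suc b

  unpair : ℕ → ℕ × ℕ
  unpair zero    = 0 , 0
  unpair (suc n) = step (unpair n)

  unpair-surjective : ∀ a b → ∃ λ n → unpair n ≡ (a , b)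
  unpair-surjective a b = go (a ℕ.+ b) a b refl
    where
    next : ∀ {p q} → step p ≡ q → (∃ λ n → unpair n ≡ p) → ∃ λ n → unpair n ≡ q
    next e (n , refl) = suc n , e

    go : ∀ s a b → a ℕ.+ b ≡ s → ∃ λ n → unpair n ≡ (a , b)
    go s       a       (suc b) e =
      next refl (go s (suc a) b (trans (sym (ℕₚ.+-suc a b)) e))
    go s       zero    zero    e = 0 , refl
    go (suc s) (suc a) zero    e =
      next refl (go s zero a (trans (sym (ℕₚ.+-identityʳ a)) (ℕₚ.suc-injective e)))

  module _ (em : ExcludedMiddle 0ℓ) where

    ≤-or-> : ∀ s t → s ≤ t ⊎ t < s
    ≤-or-> nil     t       = inj₁ tt
    ≤-or-> (sup f) nil     = inj₂ (0 , tt)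
    ≤-or-> (sup f) (sup g) with em {∃ λ n → ∀ m → g m < f n}
    ... | yes (n , p) = inj₂ (n , sup-least g (f n) p)
    ... | no ¬p = inj₁ λ n → bounded n
      where
      bounded : ∀ n → ∃ λ m → f n ≤ g m
      bounded n with em {∃ λ m → f n ≤ g m}
      ... | yes q = q
      ... | no ¬q = ⊥-elim (¬p (n , λ m → above m (≤-or-> (f n) (g m))))
        where
        above : ∀ m → f n ≤ g m ⊎ g m < f n → g m < f n
        above m (inj₁ q) = ⊥-elim (¬q (m , q))
        above m (inj₂ q) = q

    cmp : Trichotomous _≈_ _<_
    cmp s t with ≤-or-> s t | ≤-or-> t s
    ... | inj₂ q | _      = tri> (λ p → <-irrefl s (<-trans s t s p q))
                                 (λ e → <-irrefl t (<-≤-trans t s t q (proj₁ e))) q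
    ... | inj₁ p | inj₁ q = tri≈ (λ r → <-irrefl s (<-≤-trans s t s r q)) (p , q)
                                 (λ r → <-irrefl t (<-≤-trans t s t r p))
    ... | inj₁ p | inj₂ q = tri< q (λ e → <-irrefl s (<-≤-trans s t s q (proj₂ e)))
                                 (λ r → <-irrefl s (<-trans s t s q r))

    treeOrder : LinearOrder
    treeOrder = record
      { Carrier = Tree
      ; _≈_     = _≈_
      ; _<_     = _<_
      ; isStrictTotalOrder = record
        { isStrictPartialOrder = record
          { isEquivalence = record
            { refl  = λ {t} → ≤-refl t , ≤-refl t
            ; sym   = λ (p , q) → q , p
            ; trans = λ {r} {s} {t} (p , p′) (q , q′) →
                        ≤-trans r s t p q , ≤-trans t s r q′ p′
            }
          ; irrefl   = λ {s} {t} e p → <-irrefl s (<-≤-trans s t s p (proj₂ e))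
          ; trans    = λ {r} {s} {t} → <-trans r s t
          ; <-resp-≈ = (λ {r} {s} {t} e p → <-≤-trans r s t p (proj₁ e))
                     , (λ {r} {s} {t} e p → ≤-<-trans t s r (proj₂ e) p)
          }
        ; compare = cmp
        }
      }

    least : (P : ℕ → Set) → ∀ n → P n →
            ∃ λ k → P k × (∀ m → P m → k ℕ.≤ m)
    least P = <-rec _ λ n rec p → go n rec p
      where
      go : ∀ n →
           (∀ {k} → k ℕ.< n → P k → ∃ λ l → P l × (∀ m → P m → l ℕ.≤ m)) →
           P n → ∃ λ l → P l × (∀ m → P m → l ℕ.≤ m)
      go n rec p with em {∃ λ k → k ℕ.< n × P k}
      ... | yes (k , k<n , q) = rec k<n q
      ... | no ¬q = n , p , λ m r → ℕₚ.≮⇒≥ λ m<n → ¬q (m , m<n , r)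

    enumerate : ∀ t → ∃ λ (e : ℕ → Tree) → ∀ s → s < t → ∃ λ n → s ≈ e n
    enumerate nil     = (λ _ → nil) , λ s ()
    enumerate (sup g) = (λ n → uncurry value (unpair n)) , covers
      where
      value : ℕ → ℕ → Tree
      value m zero    = g m
      value m (suc k) = proj₁ (enumerate (g m)) k

      at : ∀ s m k → s ≈ value m k → ∃ λ n → s ≈ uncurry value (unpair n)
      at s m k e = let (n , eq) = unpair-surjective m k
                   in n , subst (λ p → s ≈ uncurry value p) (sym eq) e

      covers : ∀ s → s < sup g → ∃ λ n → s ≈ uncurry value (unpair n)
      covers s (m , p) with ≤-or-> (g m) s
      ... | inj₁ q = at s m 0 (p , q)
      ... | inj₂ q = let (k , e) = proj₂ (enumerate (g m)) s q in at s m (suc k) e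

    treeOrder-isFirstUncountable : IsFirstUncountableOrdinal treeOrder
    treeOrder-isFirstUncountable = record
      { wellFounded = <-wf
      ; uncountable = uncountable
      ; first       = first
      }
      where
      open StrictTotalOrder treeOrder using (module Eq)

      uncountable : ¬ Countable (pointSetoid treeOrder)
      uncountable inj = <-irrefl top (to top , proj₂ (hit (to top) top refl))
        where
        open Injection inj using (to; injective)
        inverse : ℕ → Tree
        inverse n with em {∃ λ t → to t ≡ n}
        ... | yes (t , _) = t
        ... | no _        = nil
        hit : ∀ n t → to t ≡ n → inverse n ≈ t
        hit n t e with em {∃ λ t → to t ≡ n}
        ... | yes (t′ , e′) = injective (trans e′ (sym e))
        ... | no ¬p         = ⊥-elim (¬p (t , e))
        top : Tree
        top = sup inverse

      first : ∀ t → Countable (segment treeOrder t)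
      first t = record
        { to        = λ x → proj₁ (code x)
        ; cong      = λ {x} {y} x≈y → ℕₚ.≤-antisym
            (proj₂ (proj₂ (code x)) _ (Eq.trans x≈y (proj₁ (proj₂ (code y)))))
            (proj₂ (proj₂ (code y)) _ (Eq.trans (Eq.sym x≈y) (proj₁ (proj₂ (code x)))))
        ; injective = λ {x} {y} eq → Eq.trans (proj₁ (proj₂ (code x)))
            (Eq.sym (subst (λ n → proj₁ y ≈ proj₁ (enumerate t) n) (sym eq)
                           (proj₁ (proj₂ (code y)))))
        }
        where
        code : (x : Σ Tree (_< t)) →
               ∃ λ k → proj₁ x ≈ proj₁ (enumerate t) k
                     × (∀ m → proj₁ x ≈ proj₁ (enumerate t) m → k ℕ.≤ m)
        code (s , p) = let (n , e) = proj₂ (enumerate t) s p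
                       in least (λ n → s ≈ proj₁ (enumerate t) n) n e

ω₁-exists : ExcludedMiddle 0ℓ → ∃ IsFirstUncountableOrdinal
ω₁-exists em = treeOrder em , treeOrder-isFirstUncountable em

{-# OPTIONS --safe #-}
module Submission where

-- Let A = ω₁* + ω₁.  Points of Z b are pairs (u , f) of a sequence u in A with
-- eventually alternating signs and a sequence f in ℕ that is eventually 0 or 1
-- according to the sign of u (and to the parity b); u is compared at the first
-- difference and, below it, f at the last.  Shifting u removes a left factor A,
-- shifting f a right factor ω, and either shift changes b.  The fibre of Z b
-- over u consists of the f eventually equal to a given sequence, and an
-- isomorphism of such fibres fixes every digit, since ω can be cancelled on the
-- right.  Finally, an isomorphism Z b ≅ Z c maps the fibre over some alternating
-- w to the fibre over w, which forces b = c: a continuous increasing ω₁-sequence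
-- and its image agree on a club, so one finds λ₀ such that the cut before the
-- block of λ₀ is fixed, then λ₁ such that the cut after the block of (λ₀ , -λ₁)
-- is fixed, and so on, alternating the two ends of A.

open import Defs
open import Axiom.ExcludedMiddle using (ExcludedMiddle)
open import Axiom.Extensionality.Propositional using (Extensionality)
open import Data.Bool.Base using (Bool; true; false; not; _xor_)
open import Data.Bool.Properties as Bool using (not-involutive; ¬-not)
open import Data.Empty using (⊥-elim)
open import Data.Nat.Base as ℕ using (ℕ; zero; suc)
import Data.Nat.Induction as ℕᵢ
import Data.Nat.Properties as ℕₚ
open import Data.Product.Base using (Σ; ∃; _×_; _,_; proj₁; proj₂; map₂; uncurry)
import Data.Product.Relation.Binary.Lex.Strict as Lex
open import Data.Product.Relation.Binary.Pointwise.NonDependent using (Pointwise)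
open import Data.Sum.Base using (_⊎_; inj₁; inj₂; [_,_]′)
open import Data.Sum.Relation.Binary.LeftOrder using (₁∼₂; ₁∼₁; ₂∼₂)
open import Data.Sum.Relation.Binary.Pointwise using (inj₁; inj₂)
open import Function.Base using (_∘_; id)
open import Function.Bundles using (Injection)
open import Induction.WellFounded using (WellFounded; Acc; acc)
open import Level using (0ℓ)
open import Relation.Binary.Bundles using (Setoid; StrictTotalOrder)
open import Relation.Binary.Core using (Rel)
import Relation.Binary.Construct.On as On
open import Relation.Binary.Definitions using (Tri; tri<; tri≈; tri>)
import Relation.Binary.Morphism.Construct.Composition as Compose
open import Relation.Binary.Morphism.Structures using (IsOrderIsomorphism)
open import Relation.Binary.PropositionalEquality
  using (_≡_; _≗_; refl; sym; trans; cong; subst)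
open import Relation.Binary.Structures using (IsStrictPartialOrder)
open import Relation.Nullary using (¬_; contradiction; yes; no)

-- Isomorphisms of linear orders

connex⇒tri : {A : Set} {_≈_ _<_ : Rel A 0ℓ} → IsStrictPartialOrder _≈_ _<_ →
             ∀ {x y} → x < y ⊎ x ≈ y ⊎ y < x → Tri (x < y) (x ≈ y) (y < x)
connex⇒tri spo = λ where
    (inj₁ x<y)        → tri< x<y (λ e → irrefl e x<y) (asym x<y)
    (inj₂ (inj₁ x≈y)) → tri≈ (irrefl x≈y) x≈y (irrefl (Eq.sym x≈y))
    (inj₂ (inj₂ y<x)) → tri> (asym y<x) (λ e → irrefl (Eq.sym e) y<x) y<x
  where open IsStrictPartialOrder spo

module _ {X Y : LinearOrder} where
  private
    module X = StrictTotalOrder X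
    module Y = StrictTotalOrder Y

  mono⇒≅ : (f : X.Carrier → Y.Carrier) →
           (∀ {x y} → x X.≈ y → f x Y.≈ f y) →
           (∀ {x y} → x X.< y → f x Y.< f y) →
           (∀ y → ∃ λ x → f x Y.≈ y) → X ≅ Y
  mono⇒≅ f f-cong f-mono surj = f , record
    { isOrderMonomorphism = record
      { isOrderHomomorphism = record { cong = f-cong ; mono = f-mono }
      ; injective           = injective
      ; cancel              = cancel
      }
    ; surjective = λ y → proj₁ (surj y) , λ e → Y.Eq.trans (f-cong e) (proj₂ (surj y))
    }
    where
    injective : ∀ {x y} → f x Y.≈ f y → x X.≈ y
    injective {x} {y} e with X.compare x y
    ... | tri< x<y _ _ = ⊥-elim (Y.irrefl e (f-mono x<y))
    ... | tri≈ _ x≈y _ = x≈y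
    ... | tri> _ _ y<x = ⊥-elim (Y.irrefl (Y.Eq.sym e) (f-mono y<x))

    cancel : ∀ {x y} → f x Y.< f y → x X.< y
    cancel {x} {y} l with X.compare x y
    ... | tri< x<y _ _ = x<y
    ... | tri≈ _ x≈y _ = ⊥-elim (Y.irrefl (f-cong x≈y) l)
    ... | tri> _ _ y<x = ⊥-elim (Y.asym l (f-mono y<x))

  module Iso (φ : X ≅ Y) where
    open IsOrderIsomorphism (proj₂ φ) public
      renaming (cong to to-cong; mono to to-mono) using (cancel; injective; surjective)

    to : X.Carrier → Y.Carrier
    to = proj₁ φ

    from : Y.Carrier → X.Carrier
    from y = proj₁ (surjective y)

    to-from : ∀ y → to (from y) Y.≈ y
    to-from y = proj₂ (surjective y) X.Eq.refl

    from-to : ∀ x → from (to x) X.≈ x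
    from-to x = injective (to-from (to x))

    from-mono : ∀ {x y} → x Y.< y → from x X.< from y
    from-mono {x} {y} l = cancel
      (Y.<-respʳ-≈ (Y.Eq.sym (to-from y)) (Y.<-respˡ-≈ (Y.Eq.sym (to-from x)) l))

    from-cong : ∀ {x y} → x Y.≈ y → from x X.≈ from y
    from-cong {x} {y} e = injective
      (Y.Eq.trans (to-from x) (Y.Eq.trans e (Y.Eq.sym (to-from y))))

≅-sym : {X Y : LinearOrder} → X ≅ Y → Y ≅ X
≅-sym {X} {Y} φ = mono⇒≅ {Y} {X} from from-cong from-mono (λ x → to x , from-to x)
  where open Iso {X} {Y} φ

≅-trans : {X Y Z : LinearOrder} → X ≅ Y → Y ≅ Z → X ≅ Z
≅-trans {Z = Z} (f , φ) (g , ψ) =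
  g ∘ f , Compose.isOrderIsomorphism (StrictTotalOrder.Eq.trans Z) φ ψ

-- Cancelling ω on the right

module _ {X : LinearOrder} where
  private
    module X  = StrictTotalOrder X
    module Xω = StrictTotalOrder (X ⊗ ω)

  <-step : ∀ x k → (x , k) Xω.< (x , suc k)
  <-step x k = inj₂ (X.Eq.refl , ℕₚ.≤-refl)

  no-between : ∀ {x k z} → (x , k) Xω.< z → ¬ z Xω.< (x , suc k)
  no-between (inj₁ p)       (inj₁ q)       = X.asym p q
  no-between (inj₁ p)       (inj₂ (e , _)) = X.irrefl (X.Eq.sym e) p
  no-between (inj₂ (e , _)) (inj₁ q)       = X.irrefl (X.Eq.sym e) q
  no-between (inj₂ (_ , p)) (inj₂ (_ , ℕ.s≤s q)) = ℕₚ.<⇒≱ p q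

-- (x , 0) has no immediate predecessor while (x , k + 1) succeeds (x , k), so
-- an isomorphism preserves the ω-coordinate.
module _ {X Y : LinearOrder} (φ : X ⊗ ω ≅ Y ⊗ ω) where
  private
    module X  = StrictTotalOrder X
    module Y  = StrictTotalOrder Y
    module Yω = StrictTotalOrder (Y ⊗ ω)
    open Iso {X ⊗ ω} {Y ⊗ ω} φ

  private
    zero↦zero : ∀ x → proj₂ (to (x , 0)) ≡ 0
    zero↦zero x with to (x , 0) in eq
    ... | y , zero  = refl
    ... | y , suc k = ⊥-elim (go (from (y , k)) (to-from (y , k)))
      where
      go : ∀ z → ¬ to z Yω.≈ (y , k)
      go (x′ , k′) e with cancel (Yω.<-respˡ-≈ (Yω.Eq.sym e)
                           (subst ((y , k) Yω.<_) (sym eq) (<-step {Y} y k)))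
      -- `(x′ , suc k′)` is still below `(x , 0)`, so its image would lie strictly between `(y , k)`
      -- and its immediate successor.
      ... | inj₁ x′<x = no-between {Y} {y} {k}
        (Yω.<-respˡ-≈ e (to-mono (<-step {X} x′ k′)))
        (subst (to (x′ , suc k′) Yω.<_) eq (to-mono (inj₁ x′<x)))

    base : X.Carrier → Y.Carrier
    base x = proj₁ (to (x , 0))

    to-base : ∀ x k → to (x , k) Yω.≈ (base x , k)
    to-base x zero    = Y.Eq.refl , zero↦zero x
    to-base x (suc k) with Yω.compare (to (x , suc k)) (base x , suc k)
    ... | tri≈ _ e _ = e
    ... | tri< l _ _ = ⊥-elim (no-between {Y} {base x} {k}
      (Yω.<-respˡ-≈ (to-base x k) (to-mono (<-step {X} x k))) l)
    ... | tri> _ _ l = ⊥-elim (no-between {X} {x} {k} {from (base x , suc k)}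
      (cancel (Yω.<-respˡ-≈ (Yω.Eq.sym (to-base x k))
        (Yω.<-respʳ-≈ (Yω.Eq.sym (to-from (base x , suc k))) (<-step {Y} (base x) k))))
      (cancel (Yω.<-respˡ-≈ (Yω.Eq.sym (to-from (base x , suc k))) l)))

  ⊗ω-cancelʳ : ∃ λ (ψ : X ≅ Y) → ∀ x k → to (x , k) Yω.≈ (proj₁ ψ x , k)
  ⊗ω-cancelʳ = mono⇒≅ {X} {Y} base
    (λ e → proj₁ (to-cong (e , refl)))
    base-mono
    (λ y → proj₁ (from (y , 0)) , Y.Eq.trans
      (Y.Eq.sym (proj₁ (to-base (proj₁ (from (y , 0))) (proj₂ (from (y , 0))))))
      (proj₁ (to-from (y , 0))))
    , to-base
    where
    base-mono : ∀ {x y} → x X.< y → base x Y.< base y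
    base-mono {x} {y} x<y with to-mono {x , 0} {y , 0} (inj₁ x<y)
    ... | inj₁ l       = l
    ... | inj₂ (_ , l) = ⊥-elim (ℕₚ.n≮0 (subst (proj₂ (to (x , 0)) ℕ.<_) (zero↦zero y) l))

-- Sequences compared at their last difference

infixr 5 _◂_
_◂_ : {A : Set} → A → (ℕ → A) → ℕ → A
(a ◂ u) zero    = a
(a ◂ u) (suc n) = u n

Eventually : (ℕ → Set) → Set
Eventually P = ∃ λ N → ∀ n → N ℕ.≤ n → P n

eventually-suc : ∀ {P Q : ℕ → Set} → (∀ {n} → P n → P (suc n) → Q n) →
                 Eventually P → Eventually Q
eventually-suc h (N , p) = N , λ n l → h (p n l) (p (suc n) (ℕₚ.m≤n⇒m≤1+n l))

eventually-pred : ∀ {P Q : ℕ → Set} → (∀ {n} → P n → P (suc n) → Q (suc n)) →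
                  Eventually P → Eventually Q
eventually-pred h (N , p) = suc N , λ where
  (suc n) (ℕ.s≤s l) → h (p n l) (p (suc n) (ℕₚ.m≤n⇒m≤1+n l))

eventually-zip : ∀ {P Q R : ℕ → Set} → (∀ {n} → P n → Q n → R n) →
                 Eventually P → Eventually Q → Eventually R
eventually-zip h (M , p) (N , q) = M ℕ.⊔ N , λ n l →
  h (p n (ℕₚ.≤-trans (ℕₚ.m≤m⊔n M N) l)) (q n (ℕₚ.≤-trans (ℕₚ.m≤n⊔m M N) l))

infix 4 _=*_ _≺_
_=*_ : Rel (ℕ → ℕ) 0ℓ
f =* g = Eventually λ n → f n ≡ g n

_≺_ : Rel (ℕ → ℕ) 0ℓ
f ≺ g = ∃ λ m → f m ℕ.< g m × (∀ i → m ℕ.< i → f i ≡ g i)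

≺-isStrictPartialOrder : IsStrictPartialOrder _≗_ _≺_
≺-isStrictPartialOrder = record
  { isEquivalence = record
    { refl = λ _ → refl ; sym = λ e n → sym (e n) ; trans = λ d e n → trans (d n) (e n) }
  ; irrefl   = λ e (m , l , _) → ℕₚ.<-irrefl (e m) l
  ; trans    = ≺-trans
  ; <-resp-≈ = (λ e (m , l , a) → m , subst (_ ℕ.<_) (e m) l , λ i p → trans (a i p) (e i))
             , (λ e (m , l , a) → m , subst (ℕ._< _) (e m) l , λ i p → trans (sym (e i)) (a i p))
  }
  where
  ≺-trans : ∀ {f g h} → f ≺ g → g ≺ h → f ≺ h
  ≺-trans {f} {g} {h} (m , l , a) (n , k , b) with ℕₚ.<-cmp m n
  ... | tri< m<n _ _ = n , subst (ℕ._< h n) (sym (a n m<n)) k ,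
                       λ i p → trans (a i (ℕₚ.<-trans m<n p)) (b i p)
  ... | tri≈ _ refl _ = m , ℕₚ.<-trans l k , λ i p → trans (a i p) (b i p)
  ... | tri> _ _ n<m = m , subst (f m ℕ.<_) (b m n<m) l ,
                       λ i p → trans (a i p) (b i (ℕₚ.<-trans n<m p))

-- Scan downwards from the bound of agreement: the first discrepancy met is the last difference.
≺-connex : ∀ {f g} → f =* g → f ≺ g ⊎ f ≗ g ⊎ g ≺ f
≺-connex {f} {g} = uncurry go
  where
  go : ∀ N → (∀ n → N ℕ.≤ n → f n ≡ g n) → f ≺ g ⊎ f ≗ g ⊎ g ≺ f
  go zero    a = inj₂ (inj₁ λ n → a n ℕ.z≤n)
  go (suc N) a with ℕₚ.<-cmp (f N) (g N)
  ... | tri< l _ _ = inj₁ (N , l , a)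
  ... | tri> _ _ l = inj₂ (inj₂ (N , l , λ i p → sym (a i p)))
  ... | tri≈ _ e _ = go N λ n l → [ a n , (λ { refl → e }) ]′ (ℕₚ.m≤n⇒m<n∨m≡n l)

-- Restricting to one class of eventual equality makes `_≺_` total, since a last difference then
-- exists.
Tails : (ℕ → ℕ) → LinearOrder
Tails p = record
  { Carrier = Σ (ℕ → ℕ) (_=* p)
  ; isStrictTotalOrder = record
    { isStrictPartialOrder = spo
    ; compare = λ f g → connex⇒tri spo {f} {g}
        (≺-connex (eventually-zip (λ x y → trans x (sym y)) (proj₂ f) (proj₂ g)))
    }
  }
  where spo = On.isStrictPartialOrder proj₁ ≺-isStrictPartialOrder

tails-⊗ω : ∀ p → Tails p ≅ Tails (p ∘ suc) ⊗ ω
tails-⊗ω p = mono⇒≅ {Tails p} {Tails (p ∘ suc) ⊗ ω}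
  (λ (f , e) → (f ∘ suc , eventually-suc {Q = λ n → f (suc n) ≡ p (suc n)} (λ _ → id) e) , f 0)
  (λ e → (e ∘ suc) , e 0)
  (λ where
    (zero  , l , a) → inj₂ ((λ i → a (suc i) (ℕ.s≤s ℕ.z≤n)) , l)
    (suc m , l , a) → inj₁ (m , l , λ i q → a (suc i) (ℕ.s≤s q)))
  (λ ((f , (N , e)) , k) → (k ◂ f , suc N , λ { (suc n) (ℕ.s≤s l) → e n l }) , (λ _ → refl) , refl)

-- Digit 0 is the least significant, so it is the ω-coordinate of `tails-⊗ω`, which every
-- isomorphism keeps. Cancelling ω leaves an isomorphism of the shifted orders, and induction on the
-- index treats the later digits.
tails-rigid : ∀ {p q} (φ : Tails p ≅ Tails q) f → proj₁ (proj₁ φ f) ≗ proj₁ f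
tails-rigid {p} {q} φ f = go
  where
  P = Tails (p ∘ suc)
  Q = Tails (q ∘ suc)
  module Split = Iso {Tails p} {P ⊗ ω} (tails-⊗ω p)
  cancelled = ⊗ω-cancelʳ {P} {Q}
    (≅-trans {P ⊗ ω} {Tails q} {Q ⊗ ω}
      (≅-trans {P ⊗ ω} {Tails p} {Tails q} (≅-sym {Tails p} {P ⊗ ω} (tails-⊗ω p)) φ)
      (tails-⊗ω q))
  tail = proj₁ (Split.to f)
  split : proj₁ (proj₁ φ f) ≗ (proj₁ f 0 ◂ proj₁ (proj₁ (proj₁ cancelled) tail))
  split n = trans
    -- Passing to `from (to f)` brings the argument into the split form on which the cancelled
    -- isomorphism is defined.
    (IsOrderIsomorphism.cong (proj₂ φ) {f} {Split.from (Split.to f)}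
       (λ i → sym (Split.from-to f i)) n)
    (digits n)
    where
    e = proj₂ cancelled tail (proj₁ f 0)
    digits : proj₁ (proj₁ φ (Split.from (Split.to f)))
             ≗ (proj₁ f 0 ◂ proj₁ (proj₁ (proj₁ cancelled) tail))
    digits zero    = proj₂ e
    digits (suc i) = proj₁ e i
  go : proj₁ (proj₁ φ f) ≗ proj₁ f
  go zero    = split zero
  go (suc n) = trans (split (suc n)) (tails-rigid (proj₁ cancelled) tail n)

-- The image of `p` itself has the digits of `p` by rigidity and is eventually `q` by membership.
tails-injective : ∀ {p q} → Tails p ≅ Tails q → p =* q
tails-injective {p} {q} φ =
  map₂ (λ e n l → trans (sym (tails-rigid φ (p , 0 , λ _ _ → refl) n)) (e n l))
       (proj₂ (proj₁ φ (p , 0 , λ _ _ → refl)))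

-- Countability and ω₁

-- An injective, not surjective, pairing: with s = a + b the codes lie between s² and s² + s, hence
-- below (s + 1)².
pair : ℕ → ℕ → ℕ
pair a b = (a ℕ.+ b) ℕ.* (a ℕ.+ b) ℕ.+ b

pair-< : ∀ {a b c d} → a ℕ.+ b ℕ.< c ℕ.+ d → pair a b ℕ.< pair c d
pair-< {a} {b} {c} {d} l = begin-strict
  s ℕ.* s ℕ.+ b    ≤⟨ ℕₚ.+-monoʳ-≤ (s ℕ.* s) (ℕₚ.m≤n+m b a) ⟩
  s ℕ.* s ℕ.+ s    ≡⟨ ℕₚ.+-comm (s ℕ.* s) s ⟩
  suc s ℕ.* s      <⟨ ℕₚ.*-monoʳ-< (suc s) ℕₚ.≤-refl ⟩
  suc s ℕ.* suc s  ≤⟨ ℕₚ.*-mono-≤ l l ⟩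
  t ℕ.* t          ≤⟨ ℕₚ.m≤m+n (t ℕ.* t) d ⟩
  t ℕ.* t ℕ.+ d    ∎
  where
  open ℕₚ.≤-Reasoning
  s = a ℕ.+ b
  t = c ℕ.+ d

pair-injective : ∀ {a b c d} → pair a b ≡ pair c d → a ≡ c × b ≡ d
pair-injective {a} {b} {c} {d} e with ℕₚ.<-cmp (a ℕ.+ b) (c ℕ.+ d)
... | tri< l _ _ = ⊥-elim (ℕₚ.<⇒≢ (pair-< {a} {b} {c} {d} l) e)
... | tri> _ _ l = ⊥-elim (ℕₚ.<⇒≢ (pair-< {c} {d} {a} {b} l) (sym e))
... | tri≈ _ s _ = ℕₚ.+-cancelʳ-≡ b a c (trans s (cong (c ℕ.+_) (sym b≡d))) , b≡d
  where
  b≡d = ℕₚ.+-cancelˡ-≡ ((c ℕ.+ d) ℕ.* (c ℕ.+ d)) b d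
          (subst (λ t → t ℕ.* t ℕ.+ b ≡ pair c d) s e)

module _ (em : ExcludedMiddle 0ℓ) where

  minimal : {A : Set} {_<_ : Rel A 0ℓ} → WellFounded _<_ → (P : A → Set) →
            ∃ P → ∃ λ m → P m × (∀ x → x < m → ¬ P x)
  minimal {A} {_<_} wf P (a , p) = go (wf a) p
    where
    go : ∀ {a} → Acc _<_ a → P a → ∃ λ m → P m × (∀ x → x < m → ¬ P x)
    go {a} (acc rec) p with em {∃ λ x → x < a × P x}
    ... | yes (x , l , q) = go (rec l) q
    ... | no  none        = a , p , λ x l q → none (x , l , q)

  least : (P : ℕ → Set) → ∃ P → ∃ λ m → P m × (∀ n → P n → m ℕ.≤ n)
  least P p = let m , q , min = minimal ℕᵢ.<-wellFounded P p
              in m , q , λ n r → ℕₚ.≮⇒≥ λ l → min n l r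

  -- An element may have many codes; choosing the least one makes the map respect `≈`.
  relation⇒countable : (S : Setoid 0ℓ 0ℓ) → let open Setoid S in
    (Code : Carrier → ℕ → Set) → (∀ x → ∃ (Code x)) →
    (∀ {x y k} → x ≈ y → Code x k → Code y k) →
    (∀ {x y k} → Code x k → Code y k → x ≈ y) → Countable S
  relation⇒countable S Code total resp inj = record
    { to        = code
    ; cong      = λ e → ℕₚ.≤-antisym (code-≤ e) (code-≤ (Setoid.sym S e))
    ; injective = λ {x} {y} e → inj (code-Code x) (subst (Code y) (sym e) (code-Code y))
    }
    where
    code = λ x → proj₁ (least (Code x) (total x))
    code-Code : ∀ x → Code x (code x)
    code-Code x = proj₁ (proj₂ (least (Code x) (total x)))
    code-≤ : ∀ {x y} → Setoid._≈_ S x y → code x ℕ.≤ code y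
    code-≤ {x} {y} e = proj₂ (proj₂ (least (Code x) (total x))) (code y)
                         (resp (Setoid.sym S e) (code-Code y))

  -- Uncountable cofinality of ω₁ and its clubs

  module FirstUncountable (Ω : LinearOrder) (isΩ : IsFirstUncountableOrdinal Ω) where
    open StrictTotalOrder Ω using (Carrier; _≈_; _<_; compare; <-respˡ-≈; <-respʳ-≈; module Eq)
    open IsFirstUncountableOrdinal isΩ

    point : Carrier
    point with em {Carrier}
    ... | yes x = x
    ... | no ¬x = ⊥-elim (uncountable record
      { to = λ x → ⊥-elim (¬x x) ; cong = λ {x} → ⊥-elim (¬x x) ; injective = λ {x} → ⊥-elim (¬x x) })

    -- Without a bound every γ is at most some `e n`, so Ω is a countable union of countable closed
    -- segments. The code `pair n 0` stands for the endpoint `e n`, and positive second entries for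
    -- the points below it.
    bounded : (e : ℕ → Carrier) → ∃ λ γ → ∀ n → e n < γ
    bounded e with em {∃ λ γ → ∀ n → e n < γ}
    ... | yes b = b
    ... | no ¬b = ⊥-elim (uncountable (relation⇒countable (pointSetoid Ω) Code total
                    (λ {x} {y} {k} → resp {x} {y} {k}) (λ {x} {y} {k} → inj {x} {y} {k})))
      where
      rank : ∀ n γ → γ < e n → ℕ
      rank n γ p = Injection.to (first (e n)) (γ , p)

      Code : Carrier → ℕ → Set
      Code γ k = (∃ λ n → Σ (γ < e n) λ p → k ≡ pair n (suc (rank n γ p)))
               ⊎ (∃ λ n → γ ≈ e n × k ≡ pair n 0)

      total : ∀ γ → ∃ (Code γ)
      total γ with em {∃ λ n → ¬ e n < γ}
      ... | no all = ⊥-elim (¬b (γ , λ n → below n))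
        where
        below : ∀ n → e n < γ
        below n with em {e n < γ}
        ... | yes l = l
        ... | no ¬l = ⊥-elim (all (n , ¬l))
      ... | yes (n , ¬l) with compare γ (e n)
      ... | tri< l _ _ = _ , inj₁ (n , l , refl)
      ... | tri≈ _ l _ = _ , inj₂ (n , l , refl)
      ... | tri> _ _ l = ⊥-elim (¬l l)

      resp : ∀ {x y k} → x ≈ y → Code x k → Code y k
      resp x≈y (inj₁ (n , l , k)) = inj₁ (n , <-respˡ-≈ x≈y l ,
        trans k (cong (pair n ∘ suc) (Injection.cong (first (e n)) x≈y)))
      resp x≈y (inj₂ (n , l , k)) = inj₂ (n , Eq.trans (Eq.sym x≈y) l , k)

      inj : ∀ {x y k} → Code x k → Code y k → x ≈ y
      inj (inj₁ (n , p , refl)) (inj₁ (m , q , eq)) with pair-injective {n} {_} {m} eq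
      ... | refl , r = Injection.injective (first (e n)) (ℕₚ.suc-injective r)
      inj (inj₁ (n , p , refl)) (inj₂ (m , q , eq)) with pair-injective {n} {_} {m} eq
      ... | _ , ()
      inj (inj₂ (n , p , refl)) (inj₁ (m , q , eq)) with pair-injective {n} {_} {m} eq
      ... | _ , ()
      inj (inj₂ (n , p , refl)) (inj₂ (m , q , eq)) with pair-injective {n} {_} {m} eq
      ... | refl , _ = Eq.trans p (Eq.sym q)

    bounded₃ : ∀ α β γ → ∃ λ δ → α < δ × β < δ × γ < δ
    bounded₃ α β γ = let δ , l = bounded (α ◂ β ◂ λ _ → γ) in δ , l 0 , l 1 , l 2

    -- The points closed under R form a club; this one is the supremum of an
    -- increasing sequence whose consecutive terms are R-related.
    closed-limit : (R : Carrier → Carrier → Set) → (∀ α → ∃ λ β → α < β × R α β) →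
                   ∃ λ γ → ∃ (_< γ) ×
                     (∀ {α} → α < γ → ∃ λ β → ∃ λ δ → α < β × δ < γ × R β δ)
    closed-limit R next = γ , (a 0 , below 0) , approach
      where
      a : ℕ → Carrier
      a zero    = point
      a (suc n) = proj₁ (next (a n))

      a-mono : ∀ n → a n < a (suc n)
      a-mono n = proj₁ (proj₂ (next (a n)))

      supremum = minimal wellFounded (λ γ → ∀ n → a n < γ) (bounded a)
      γ = proj₁ supremum
      below = proj₁ (proj₂ supremum)

      approach : ∀ {α} → α < γ → ∃ λ β → ∃ λ δ → α < β × δ < γ × R β δ
      approach {α} α<γ with em {∃ λ n → α < a n}
      ... | yes (n , l) = a n , a (suc n) , l , below (suc n) , proj₂ (proj₂ (next (a n)))
      ... | no none = ⊥-elim (proj₂ (proj₂ supremum) α α<γ bound)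
        where
        bound : ∀ n → a n < α
        bound n with compare α (a n)
        ... | tri< l _ _ = ⊥-elim (none (n , l))
        ... | tri≈ _ e _ = ⊥-elim (none (suc n , <-respˡ-≈ (Eq.sym e) (a-mono n)))
        ... | tri> _ _ l = l

-- Lexicographic order at the first difference

module Lexicographic (A : LinearOrder) where
  private
    module A = StrictTotalOrder A

  Seq : Set
  Seq = ℕ → A.Carrier

  infix 4 _≋_ _<ₗ_ _<[_]_
  -- The Boolean selects the direction, so that one argument serves both ends of the order.
  _<[_]_ : A.Carrier → Bool → A.Carrier → Set
  a <[ false ] b = a A.< b
  a <[ true  ] b = b A.< a

  <[]-resp : ∀ σ {a b c d} → a A.≈ b → c A.≈ d → a <[ σ ] c → b <[ σ ] d
  <[]-resp false e f l = A.<-respʳ-≈ f (A.<-respˡ-≈ e l)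
  <[]-resp true  e f l = A.<-respʳ-≈ e (A.<-respˡ-≈ f l)

  <[]-trans : ∀ σ {a b c} → a <[ σ ] b → b <[ σ ] c → a <[ σ ] c
  <[]-trans false k l = A.trans k l
  <[]-trans true  k l = A.trans l k

  <[]-irrefl : ∀ σ {a b} → a A.≈ b → ¬ a <[ σ ] b
  <[]-irrefl false e = A.irrefl e
  <[]-irrefl true  e = A.irrefl (A.Eq.sym e)

  <[]-connex : ∀ σ a b → a <[ σ ] b ⊎ a A.≈ b ⊎ a <[ not σ ] b
  <[]-connex σ a b with A.compare a b
  <[]-connex false a b | tri< l _ _ = inj₁ l
  <[]-connex true  a b | tri< l _ _ = inj₂ (inj₂ l)
  <[]-connex _     a b | tri≈ _ e _ = inj₂ (inj₁ e)
  <[]-connex false a b | tri> _ _ l = inj₂ (inj₂ l)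
  <[]-connex true  a b | tri> _ _ l = inj₁ l

  _≋_ : Rel Seq 0ℓ
  u ≋ v = ∀ n → u n A.≈ v n

  ≋-sym : ∀ {u v} → u ≋ v → v ≋ u
  ≋-sym e n = A.Eq.sym (e n)

  ≋-trans : ∀ {u v w} → u ≋ v → v ≋ w → u ≋ w
  ≋-trans d e n = A.Eq.trans (d n) (e n)

  Agree : ℕ → Rel Seq 0ℓ
  Agree n u v = ∀ i → i ℕ.< n → u i A.≈ v i

  _<ₗ_ : Rel Seq 0ℓ
  u <ₗ v = ∃ λ m → Agree m u v × u m A.< v m

  <ₗ-isStrictPartialOrder : IsStrictPartialOrder _≋_ _<ₗ_
  <ₗ-isStrictPartialOrder = record
    { isEquivalence = record { refl = λ _ → A.Eq.refl ; sym = ≋-sym ; trans = ≋-trans }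
    ; irrefl   = λ e (m , _ , l) → A.irrefl (e m) l
    ; trans    = <ₗ-trans
    ; <-resp-≈ =
        (λ e (m , a , l) → m , (λ i p → A.Eq.trans (a i p) (e i)) , A.<-respʳ-≈ (e m) l)
      , (λ e (m , a , l) → m , (λ i p → A.Eq.trans (A.Eq.sym (e i)) (a i p)) , A.<-respˡ-≈ (e m) l)
    }
    where
    <ₗ-trans : ∀ {u v w} → u <ₗ v → v <ₗ w → u <ₗ w
    <ₗ-trans (m , a , k) (n , b , l) with ℕₚ.<-cmp m n
    ... | tri< m<n _ _ = m , (λ i p → A.Eq.trans (a i p) (b i (ℕₚ.<-trans p m<n))) ,
                         A.<-respʳ-≈ (b m m<n) k
    ... | tri≈ _ refl _ = m , (λ i p → A.Eq.trans (a i p) (b i p)) , A.trans k l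
    ... | tri> _ _ n<m = n , (λ i p → A.Eq.trans (a i (ℕₚ.<-trans p n<m)) (b i p)) ,
                         A.<-respˡ-≈ (A.Eq.sym (a n n<m)) l

  -- For σ = false this is the initial segment of sequences lying strictly
  -- before all the sequences that extend w 0, …, w (n - 1); for σ = true it is
  -- the final segment of those lying after.
  Below : Bool → ℕ → Seq → Seq → Set
  Below σ n w u = ∃ λ i → i ℕ.< n × Agree i u w × u i <[ σ ] w i

  below-weaken : ∀ σ {m n w u} → m ℕ.≤ n → Below σ m w u → Below σ n w u
  below-weaken σ m≤n (i , l , r) = i , ℕₚ.≤-trans l m≤n , r

  below-congʳ : ∀ σ {n w w′ u} → Agree n w w′ → Below σ n w u → Below σ n w′ u
  below-congʳ σ e (i , l , a , p) =
    i , l , (λ j q → A.Eq.trans (a j q) (e j (ℕₚ.<-trans q l))) , <[]-resp σ A.Eq.refl (e i l) p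

  below-respˡ : ∀ σ {n w u v} → u ≋ v → Below σ n w v → Below σ n w u
  below-respˡ σ e (i , l , a , p) = i , l , (λ j q → A.Eq.trans (e j) (a j q)) ,
    <[]-resp σ (A.Eq.sym (e i)) A.Eq.refl p

  agree⇒¬below : ∀ σ {n w u} → Agree n u w → ¬ Below σ n w u
  agree⇒¬below σ a (i , l , _ , p) = <[]-irrefl σ (a i l) p

  Differ : Bool → Rel Seq 0ℓ
  Differ σ u v = ∃ λ m → Agree m u v × u m <[ σ ] v m

  below-down : ∀ σ {n w u v} → Differ σ u v → Below σ n w v → Below σ n w u
  below-down σ (m , a , k) (i , l , b , p) with ℕₚ.<-cmp m i
  ... | tri< m<i _ _ = m , ℕₚ.<-trans m<i l ,
                       (λ j q → A.Eq.trans (a j q) (b j (ℕₚ.<-trans q m<i))) ,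
                       <[]-resp σ A.Eq.refl (b m m<i) k
  ... | tri≈ _ refl _ = m , l , (λ j q → A.Eq.trans (a j q) (b j q)) , <[]-trans σ k p
  ... | tri> _ _ i<m = i , l , (λ j q → A.Eq.trans (a j (ℕₚ.<-trans q i<m)) (b j q)) ,
                       <[]-resp σ (A.Eq.sym (a i i<m)) A.Eq.refl p

  below-or-agree : ∀ σ n w u → Below σ n w u ⊎ Agree n u w ⊎ Below (not σ) n w u
  below-or-agree σ zero    w u = inj₂ (inj₁ λ _ ())
  below-or-agree σ (suc n) w u with below-or-agree σ n w u
  ... | inj₁ b        = inj₁ (below-weaken σ (ℕₚ.n≤1+n n) b)
  ... | inj₂ (inj₂ b) = inj₂ (inj₂ (below-weaken (not σ) (ℕₚ.n≤1+n n) b))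
  ... | inj₂ (inj₁ a) with <[]-connex σ (u n) (w n)
  ... | inj₁ p        = inj₁ (n , ℕₚ.≤-refl , a , p)
  ... | inj₂ (inj₂ p) = inj₂ (inj₂ (n , ℕₚ.≤-refl , a , p))
  ... | inj₂ (inj₁ e) = inj₂ (inj₁ λ i l →
    [ a i , (λ { refl → e }) ]′ (ℕₚ.m≤n⇒m<n∨m≡n (ℕₚ.≤-pred l)))

  infixl 9 _[_≔_]
  _[_≔_] : Seq → ℕ → A.Carrier → Seq
  (w [ n ≔ a ]) i with i ℕₚ.≟ n
  ... | yes _ = a
  ... | no  _ = w i

  update-at : ∀ w n a → (w [ n ≔ a ]) n ≡ a
  update-at w n a with n ℕₚ.≟ n
  ... | yes _ = refl
  ... | no ¬p = ⊥-elim (¬p refl)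

  update-below : ∀ w n a i → i ℕ.< n → (w [ n ≔ a ]) i ≡ w i
  update-below w n a i i<n with i ℕₚ.≟ n
  ... | yes refl = ⊥-elim (ℕₚ.<-irrefl refl i<n)
  ... | no _     = refl

  update-agree : ∀ w n a → Agree n (w [ n ≔ a ]) w
  update-agree w n a i l = A.Eq.reflexive (update-below w n a i l)

  below-update⁻ : ∀ σ {n w a u} → Below σ (suc n) (w [ n ≔ a ]) u →
                  Below σ n w u ⊎ (Agree n u w × u n <[ σ ] a)
  below-update⁻ σ {n} {w} {a} (i , l , b , p) with ℕₚ.m≤n⇒m<n∨m≡n (ℕₚ.≤-pred l)
  ... | inj₁ i<n  = inj₁ (below-congʳ σ (update-agree w n a) (i , i<n , b , p))
  ... | inj₂ refl = inj₂ ( (λ j q → A.Eq.trans (b j q) (update-agree w n a j q))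
                         , subst (_ <[ σ ]_) (update-at w n a) p)

  below-update⁺ : ∀ σ {n w a u} → Below σ n w u ⊎ (Agree n u w × u n <[ σ ] a) →
                  Below σ (suc n) (w [ n ≔ a ]) u
  below-update⁺ σ {n} {w} {a} (inj₁ b) = below-weaken σ (ℕₚ.n≤1+n n)
    (below-congʳ σ (λ i l → A.Eq.sym (update-agree w n a i l)) b)
  below-update⁺ σ {n} {w} {a} (inj₂ (b , p)) = n , ℕₚ.≤-refl ,
    (λ j q → A.Eq.trans (b j q) (A.Eq.sym (update-agree w n a j q))) ,
    subst (_ <[ σ ]_) (sym (update-at w n a)) p

  below-update-mono : ∀ σ {n w a b u} → a <[ σ ] b →
    Below σ (suc n) (w [ n ≔ a ]) u → Below σ (suc n) (w [ n ≔ b ]) u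
  below-update-mono σ a<b = below-update⁺ σ
    ∘ [ inj₁ , (λ (e , p) → inj₂ (e , <[]-trans σ p a<b)) ]′ ∘ below-update⁻ σ

  build : (Good : ℕ → Seq → Set) → ∃ (Good 0) →
          (∀ n {w} → Good n w → ∃ λ a → Good (suc n) (w [ n ≔ a ])) →
          ∃ λ w → ∀ n → ∃ λ v → Good n v × Agree n v w
  build Good initial extend =
    limit , λ n → proj₁ (stage n) , proj₂ (stage n) , stage-agree n
    where
    stage : ∀ n → ∃ (Good n)
    stage zero    = initial
    stage (suc n) = let a , good = extend n (proj₂ (stage n))
                    in proj₁ (stage n) [ n ≔ a ] , good

    -- Entry i is written at stage i + 1 and no later stage changes it.
    limit : Seq
    limit i = proj₁ (stage (suc i)) i

    stage-agree : ∀ n → Agree n (proj₁ (stage n)) limit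
    stage-agree (suc n) i l with ℕₚ.m≤n⇒m<n∨m≡n (ℕₚ.≤-pred l)
    ... | inj₂ refl = A.Eq.refl
    ... | inj₁ i<n  = A.Eq.trans (update-agree (proj₁ (stage n)) n _ i i<n) (stage-agree n i i<n)

  <ₗ-connex : ExcludedMiddle 0ℓ → ∀ u v → u <ₗ v ⊎ u ≋ v ⊎ v <ₗ u
  <ₗ-connex em u v with em {∃ λ i → ¬ u i A.≈ v i}
  ... | no same = inj₂ (inj₁ all)
    where
    all : u ≋ v
    all n with u n A.≟ v n
    ... | yes e = e
    ... | no ¬e = ⊥-elim (same (n , ¬e))
  -- The index n is some difference; comparing the first n + 1 entries locates the first one.
  ... | yes (n , ¬e) with below-or-agree false (suc n) v u
  ... | inj₁ (i , _ , a , p)        = inj₁ (i , a , p)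
  ... | inj₂ (inj₁ a)               = ⊥-elim (¬e (a n ℕₚ.≤-refl))
  ... | inj₂ (inj₂ (i , _ , a , p)) = inj₂ (inj₂ (i , (λ j q → A.Eq.sym (a j q)) , p))

-- Sequences with eventually alternating signs, thickened by tails

bit : Bool → ℕ
bit false = 0
bit true  = 1

bit-injective : ∀ {b c} → bit b ≡ bit c → b ≡ c
bit-injective {false} {false} _ = refl
bit-injective {true}  {true}  _ = refl

parity : ℕ → Bool
parity zero    = false
parity (suc n) = not (parity n)

xor-not-not : ∀ b c → not b xor not c ≡ b xor c
xor-not-not false c = not-involutive c
xor-not-not true  c = refl

xor-not : ∀ b c → b xor not c ≡ not b xor c
xor-not false c = refl
xor-not true  c = not-involutive c

xor-injective : ∀ {b c} d → b xor d ≡ c xor d → b ≡ c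
xor-injective {false} {false} d e = refl
xor-injective {true}  {true}  d e = refl
xor-injective {false} {true}  true ()
xor-injective {false} {true}  false ()
xor-injective {true}  {false} true ()
xor-injective {true}  {false} false ()

module Thick (em : ExcludedMiddle 0ℓ) (A : LinearOrder)
  (sign : StrictTotalOrder.Carrier A → Bool)
  (sign-cong : ∀ {a b} → StrictTotalOrder._≈_ A a b → sign a ≡ sign b) where
  private
    module A = StrictTotalOrder A
  open Lexicographic A

  Matched : Bool → Seq × (ℕ → ℕ) → Set
  Matched b (u , f) = Eventually λ n →
    sign (u (suc n)) ≡ not (sign (u n)) × f n ≡ bit (b xor sign (u n))

  -- All f over one sequence form a single class of eventual equality, hence are comparable. The
  -- extra v gives points with merely `≋` sequences a common target.
  matched⇒tail : ∀ b {u f v} → Matched b (u , f) → u ≋ v → f =* (λ n → bit (b xor sign (v n)))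
  matched⇒tail b (N , m) e = N , λ n l →
    trans (proj₂ (m n l)) (cong (λ s → bit (b xor s)) (sign-cong (e n)))

  Z : Bool → LinearOrder
  Z b = record
    { Carrier = ∃ (Matched b)
    ; isStrictTotalOrder = record
      { isStrictPartialOrder = spo
      ; compare = λ x y → connex⇒tri spo {x} {y} (connex x y)
      }
    }
    where
    spo = On.isStrictPartialOrder (proj₁ {B = Matched b})
            (Lex.×-isStrictPartialOrder <ₗ-isStrictPartialOrder ≺-isStrictPartialOrder)
    _<ₚ_ = Lex.×-Lex _≋_ _<ₗ_ _≺_
    connex : (x y : ∃ (Matched b)) → proj₁ x <ₚ proj₁ y
      ⊎ Pointwise _≋_ _≗_ (proj₁ x) (proj₁ y) ⊎ proj₁ y <ₚ proj₁ x
    connex ((u , f) , m) ((v , g) , n) with <ₗ-connex em u v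
    ... | inj₁ l        = inj₁ (inj₁ l)
    ... | inj₂ (inj₂ l) = inj₂ (inj₂ (inj₁ l))
    ... | inj₂ (inj₁ e) with ≺-connex (eventually-zip (λ x y → trans x (sym y))
                               (matched⇒tail b m e) (matched⇒tail b n (λ _ → A.Eq.refl)))
    ... | inj₁ l        = inj₁ (inj₂ (e , l))
    ... | inj₂ (inj₂ l) = inj₂ (inj₂ (inj₂ (≋-sym e , l)))
    ... | inj₂ (inj₁ d) = inj₂ (inj₁ (e , d))

  -- Dropping `u 0` matches `f n` with `u (suc n)`, whose sign is eventually opposite to that of
  -- `u n`; negating b compensates.
  Z-⊗ˡ : ∀ b → Z b ≅ A ⊗ Z (not b)
  Z-⊗ˡ b = mono⇒≅ {Z b} {A ⊗ Z (not b)}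
    (λ ((u , f) , m) → u 0 , (u ∘ suc , f) , eventually-suc
      (λ {n} (s , e) (s′ , _) → s′ , trans e (cong bit
        (trans (sym (xor-not-not b _)) (cong (not b xor_) (sym s))))) m)
    (λ (e , d) → e 0 , e ∘ suc , d)
    (λ where
      (inj₁ (zero  , a , l)) → inj₁ l
      (inj₁ (suc m , a , l)) → inj₂ (a 0 (ℕ.s≤s ℕ.z≤n) , inj₁ (m , (λ i p → a (suc i) (ℕ.s≤s p)) , l))
      (inj₂ (e , l))         → inj₂ (e 0 , inj₂ (e ∘ suc , l)))
    (λ (a , (u , f) , m) → ((a ◂ u , f) , eventually-pred
      (λ {n} (s , _) (_ , e) → s , trans e (cong bit
        (trans (cong (not b xor_) s) (xor-not-not b _)))) m) ,
      A.Eq.refl , (λ _ → A.Eq.refl) , λ _ → refl)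

  -- Dropping `f 0` matches the digit `f (suc n)` with `u n`, again one sign change off.
  Z-⊗ω : ∀ b → Z b ≅ Z (not b) ⊗ ω
  Z-⊗ω b = mono⇒≅ {Z b} {Z (not b) ⊗ ω}
    (λ ((u , f) , m) → ((u , f ∘ suc) , eventually-suc
      (λ {n} (s , _) (_ , e) → s , trans e (cong bit
        (trans (cong (b xor_) s) (xor-not b _)))) m) , f 0)
    (λ (e , d) → (e , d ∘ suc) , d 0)
    (λ where
      (inj₁ l)                   → inj₁ (inj₁ l)
      (inj₂ (e , zero  , l , a)) → inj₂ ((e , λ i → a (suc i) (ℕ.s≤s ℕ.z≤n)) , l)
      (inj₂ (e , suc m , l , a)) → inj₁ (inj₂ (e , m , l , λ i p → a (suc i) (ℕ.s≤s p))))
    (λ (((u , f) , m) , k) → ((u , k ◂ f) , eventually-pred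
      (λ {n} (s , e) (s′ , _) → s′ , trans e (cong bit
        (trans (sym (xor-not b _)) (cong (b xor_) (sym s))))) m) ,
      ((λ _ → A.Eq.refl) , λ _ → refl) , refl)

-- Monotone maps between sets of sequences over ω₁ * ⊕ ω₁

module TwoSided (em : ExcludedMiddle 0ℓ) (Ω : LinearOrder) (isΩ : IsFirstUncountableOrdinal Ω) where
  private
    module Ω = StrictTotalOrder Ω

  A : LinearOrder
  A = Ω * ⊕ Ω

  private
    module A = StrictTotalOrder A
  open FirstUncountable em Ω isΩ
  open Lexicographic A

  sign : A.Carrier → Bool
  sign (inj₁ _) = true
  sign (inj₂ _) = false

  sign-cong : ∀ {a b} → a A.≈ b → sign a ≡ sign b
  sign-cong (inj₁ _) = refl
  sign-cong (inj₂ _) = refl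

  side : Bool → Ω.Carrier → A.Carrier
  side false = inj₂
  side true  = inj₁

  sign-side : ∀ σ α → sign (side σ α) ≡ σ
  sign-side false α = refl
  sign-side true  α = refl

  side-mono : ∀ σ {α β} → α Ω.< β → side σ α <[ σ ] side σ β
  side-mono false = ₂∼₂
  side-mono true  = ₁∼₁

  side-cofinal : ∀ σ a → ∃ λ α → a <[ σ ] side σ α
  side-cofinal false (inj₁ α) = point , ₁∼₂
  side-cofinal true  (inj₂ α) = point , ₁∼₂
  side-cofinal false (inj₂ α) = let β , l , _ = bounded₃ α α α in β , ₂∼₂ l
  side-cofinal true  (inj₁ α) = let β , l , _ = bounded₃ α α α in β , ₁∼₁ l

  -- If a is on the side σ, its own index serves as α. If it is on the other side, any α below γ
  -- does, which is why γ must not be least.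
  side-limit : ∀ σ {γ a} → ∃ (Ω._< γ) → a <[ σ ] side σ γ →
               ∃ λ α → α Ω.< γ × (∀ {β} → α Ω.< β → a <[ σ ] side σ β)
  side-limit false _       (₂∼₂ l) = _ , l , ₂∼₂
  side-limit true  _       (₁∼₁ l) = _ , l , ₁∼₁
  side-limit false (α , l) ₁∼₂     = α , l , λ _ → ₁∼₂
  side-limit true  (α , l) ₁∼₂     = α , l , λ _ → ₁∼₂

  Alternating : Seq → Set
  Alternating w = ∀ i → sign (w i) ≡ parity i

  alternating-update : ∀ {w} n α → Alternating w → Alternating (w [ n ≔ side (parity n) α ])
  alternating-update n α alt i with i ℕₚ.≟ n
  ... | yes refl = sign-side (parity n) α
  ... | no _     = alt i

  -- Two maps p, q : P → Seq stand for the two coordinates of the graph of a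
  -- relation between sequences, which keeps the roles of p and q symmetric.
  module _ {P : Set} where

    -- Equality is allowed because an isomorphism might send points of different fibres into one
    -- fibre.
    WeaklyMonotone : (p q : P → Seq) → Set
    WeaklyMonotone p q = ∀ σ x y → Differ σ (p x) (p y) → Differ σ (q x) (q y) ⊎ q x ≋ q y

    Covering : (P → Seq) → Set
    Covering p = ∀ w → Alternating w → ∃ λ x → p x ≋ w

    Preserves : (p q : P → Seq) → Bool → ℕ → Seq → Set
    Preserves p q σ n w = ∀ x → Below σ n w (p x) → Below σ n w (q x)

    -- Take t with `p t` equal to `w [ n ≔ side σ α ]`. As `p t` agrees with w below n, the
    -- hypothesis forbids `q t` to lie past that cylinder in direction σ, so by cofinality some β
    -- puts the new cut beyond `q t`. Whatever precedes `p t` is carried to `q t` or before it.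
    advance : ∀ {p q} → WeaklyMonotone p q → Covering p →
              ∀ σ {n w} → (∀ α → Alternating (w [ n ≔ side σ α ])) →
              Preserves q p (not σ) n w → ∀ α → ∃ λ β → ∀ x →
              Below σ (suc n) (w [ n ≔ side σ α ]) (p x) →
              Below σ (suc n) (w [ n ≔ side σ β ]) (q x)
    advance {p} {q} mono cover σ {n} {w} alt pres α = map₂ carry top
      where
      t   = proj₁ (cover _ (alt α))
      p-t = proj₂ (cover _ (alt α))

      t-not-beyond : ¬ Below (not σ) n w (q t)
      t-not-beyond beyond = agree⇒¬below (not σ) (update-agree w n (side σ α))
        (below-respˡ (not σ) (≋-sym p-t) (pres t beyond))

      top : ∃ λ β → Below σ (suc n) (w [ n ≔ side σ β ]) (q t)
      top with below-or-agree σ n w (q t)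
      ... | inj₁ l        = point , below-update⁺ σ (inj₁ l)
      ... | inj₂ (inj₂ l) = ⊥-elim (t-not-beyond l)
      ... | inj₂ (inj₁ e) = map₂ (λ l → below-update⁺ σ (inj₂ (e , l))) (side-cofinal σ (q t n))

      carry : ∀ {β} → Below σ (suc n) (w [ n ≔ side σ β ]) (q t) → ∀ x →
              Below σ (suc n) (w [ n ≔ side σ α ]) (p x) →
              Below σ (suc n) (w [ n ≔ side σ β ]) (q x)
      carry t-below x (i , _ , a , l) =
        [ (λ d → below-down σ d t-below) , (λ e → below-respˡ σ e t-below) ]′
          (mono σ x t (i , (λ j m → A.Eq.trans (a j m) (A.Eq.sym (p-t j))) ,
                       <[]-resp σ A.Eq.refl (A.Eq.sym (p-t i)) l))

    -- If `q x` left w on either side, it would do so within some longer prefix whose cut is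
    -- preserved, and then `p x` would leave w as well.
    fibre : ∀ {p q w} → (∀ σ i → ∃ λ n → i ℕ.< n × Preserves q p σ n w) →
            ∀ x → p x ≋ w → q x ≋ w
    fibre {p} {q} {w} pres x e i =
      [ ⊥-elim ∘ not-below false , [ (λ a → a i ℕₚ.≤-refl) , ⊥-elim ∘ not-below true ]′ ]′
        (below-or-agree false (suc i) w (q x))
      where
      not-below : ∀ σ → ¬ Below σ (suc i) w (q x)
      not-below σ l = let n , i<n , pres-n = pres σ i in
        agree⇒¬below σ (λ j _ → e j) (pres-n x (below-weaken σ i<n l))

  -- A sequence whose fibre is preserved in both directions

  module BackAndForth {P : Set} {p q : P → Seq}
    (p⇒q : WeaklyMonotone p q) (q⇒p : WeaklyMonotone q p)
    (p-cover : Covering p) (q-cover : Covering q) where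

    Fixes : Bool → ℕ → Seq → Set
    Fixes σ n w = Preserves p q σ n w × Preserves q p σ n w

    fixes-subst : ∀ {σ τ n w} → σ ≡ τ → Fixes σ n w → Fixes τ n w
    fixes-subst refl = id

    -- The club argument: `R α β` says that both maps carry the cut at α into the cut at β. A
    -- sequence before the cut at a closed γ is already before the cut at some β with `R β δ` and δ
    -- below γ, so its partner is before the cut at γ.
    advance-limit : ∀ σ {n w} → (∀ α → Alternating (w [ n ≔ side σ α ])) →
                    Fixes (not σ) n w → ∃ λ γ → Fixes σ (suc n) (w [ n ≔ side σ γ ])
    advance-limit σ {n} {w} alt (p-pres , q-pres) = map₂ closed⇒fixes (closed-limit R next)
      where
      Cut : Ω.Carrier → Seq → Set
      Cut α = Below σ (suc n) (w [ n ≔ side σ α ])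

      cut-mono : ∀ {α β u} → α Ω.< β → Cut α u → Cut β u
      cut-mono l = below-update-mono σ (side-mono σ l)

      R : Ω.Carrier → Ω.Carrier → Set
      R α β = (∀ x → Cut α (p x) → Cut β (q x)) × (∀ x → Cut α (q x) → Cut β (p x))

      next : ∀ α → ∃ λ β → α Ω.< β × R α β
      next α =
        let β , to     = advance p⇒q p-cover σ alt q-pres α
            γ , from   = advance q⇒p q-cover σ alt p-pres α
            δ , l , m , m′ = bounded₃ α β γ
        in δ , l , (λ x → cut-mono m ∘ to x) , (λ x → cut-mono m′ ∘ from x)

      closed⇒fixes : ∀ {γ} → ∃ (Ω._< γ) ×
                       (∀ {α} → α Ω.< γ → ∃ λ β → ∃ λ δ → α Ω.< β × δ Ω.< γ × R β δ) →
                     Fixes σ (suc n) (w [ n ≔ side σ γ ])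
      closed⇒fixes {γ} (nonempty , closed) =
          (λ x l → let _ , _ , l′ , δ<γ , r , _ = approach l in cut-mono δ<γ (r x l′))
        , (λ x l → let _ , _ , l′ , δ<γ , _ , r = approach l in cut-mono δ<γ (r x l′))
        where
        cut-limit : ∀ {u} → Cut γ u → ∃ λ α → α Ω.< γ × (∀ {β} → α Ω.< β → Cut β u)
        cut-limit below with below-update⁻ σ below
        -- Here the sequence is separated from w before position n, so every cut at n contains it
        -- and any α below γ will do.
        ... | inj₁ l = map₂ (λ α<γ → α<γ , λ _ → below-update⁺ σ (inj₁ l)) nonempty
        ... | inj₂ (e , l) = let α , α<γ , h = side-limit σ nonempty l
                             in α , α<γ , λ m → below-update⁺ σ (inj₂ (e , h m))

        approach : ∀ {u} → Cut γ u → ∃ λ β → ∃ λ δ → Cut β u × δ Ω.< γ × R β δ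
        approach below =
          let α , α<γ , α-below  = cut-limit below
              β , δ , α<β , rest = closed α<γ
          in β , δ , α-below α<β , rest

    -- The fixed cut faces away from `parity n`, as needed to advance at position n in direction
    -- `parity n`; this yields the cut facing away from `parity (suc n)`.
    Good : ℕ → Seq → Set
    Good n w = Alternating w × Fixes (not (parity n)) n w

    initial : ∃ (Good 0)
    initial = (λ i → side (parity i) point) , (λ i → sign-side (parity i) point) ,
              (λ { x (_ , () , _) }) , (λ { x (_ , () , _) })

    extend : ∀ n {w} → Good n w → ∃ λ a → Good (suc n) (w [ n ≔ a ])
    extend n (alt , fixes) =
      let γ , fixes′ = advance-limit (parity n) (λ α → alternating-update n α alt) fixes
      in side (parity n) γ , alternating-update n γ alt ,
         fixes-subst (sym (not-involutive (parity n))) fixes′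

    fixes-cong : ∀ σ {n u v} → Agree n u v → Fixes σ n u → Fixes σ n v
    fixes-cong σ e (h , k) =
        (λ x → below-congʳ σ e ∘ h x ∘ below-congʳ σ (λ i l → A.Eq.sym (e i l)))
      , (λ x → below-congʳ σ e ∘ k x ∘ below-congʳ σ (λ i l → A.Eq.sym (e i l)))

    fixed-point : ∃ λ w → Alternating w × (∀ x → p x ≋ w → q x ≋ w) × (∀ x → q x ≋ w → p x ≋ w)
    fixed-point = map₂ good⇒fixed (build Good initial extend)
      where
      good⇒fixed : ∀ {w} → (∀ n → ∃ λ v → Good n v × Agree n v w) →
                   Alternating w × (∀ x → p x ≋ w → q x ≋ w) × (∀ x → q x ≋ w → p x ≋ w)
      good⇒fixed {w} good =
        (λ i → let v , (alt , _) , e = good (suc i)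
               in trans (sign-cong (A.Eq.sym (e i ℕₚ.≤-refl))) (alt i)) ,
        fibre (λ σ i → map₂ (map₂ proj₂) (fixed-beyond σ i)) ,
        fibre (λ σ i → map₂ (map₂ proj₁) (fixed-beyond σ i))
        where
        fixed : ∀ n → Fixes (not (parity n)) n w
        fixed n = let v , (_ , fixes) , e = good n in fixes-cong (not (parity n)) e fixes

        -- Stage i + 1 fixes a cut in direction `parity i` and stage i + 2 one in the opposite
        -- direction, so both occur beyond any i.
        fixed-beyond : ∀ σ i → ∃ λ n → i ℕ.< n × Fixes σ n w
        fixed-beyond σ i with σ Bool.≟ parity i
        ... | yes refl = suc i , ℕₚ.≤-refl ,
          fixes-subst (not-involutive (parity i)) (fixed (suc i))
        ... | no  σ≢   = suc (suc i) , ℕₚ.m≤n⇒m≤1+n ℕₚ.≤-refl ,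
          fixes-subst (trans (not-involutive (not (parity i))) (sym (¬-not σ≢))) (fixed (suc (suc i)))

-- Fibres over alternating sequences and the invariance of b

module Divisors (em : ExcludedMiddle 0ℓ) (Ω : LinearOrder) (isΩ : IsFirstUncountableOrdinal Ω) where
  open TwoSided em Ω isΩ
  open Lexicographic A
  open Thick em A sign sign-cong public
  private
    module A = StrictTotalOrder A
    module Z b = StrictTotalOrder (Z b)

  -- The same order serves for every alternating w, since the sign of `w n` is then `parity n`.
  Fibre : Bool → LinearOrder
  Fibre b = Tails (λ n → bit (b xor parity n))

  seq : ∀ b → Z.Carrier b → Seq
  seq b ((u , _) , _) = u

  include : ∀ b {w} → Alternating w → StrictTotalOrder.Carrier (Fibre b) → Z.Carrier b
  include b {w} alt (f , N , e) = (w , f) , N , λ n l →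
    trans (alt (suc n)) (cong not (sym (alt n))) ,
    trans (e n l) (cong (λ s → bit (b xor s)) (sym (alt n)))

  project : ∀ b {w} → Alternating w → (x : Z.Carrier b) → seq b x ≋ w →
            StrictTotalOrder.Carrier (Fibre b)
  project b alt ((u , f) , m) e = f , map₂ (λ h n l → trans (h n l) (cong (λ s → bit (b xor s)) (alt n)))
                                           (matched⇒tail b m e)

  module _ {b c : Bool} (φ : Z b ≅ Z c) where
    open Iso {Z b} {Z c} φ

    image : Z.Carrier b → Seq
    image x = seq c (to x)

    seq⇒image : WeaklyMonotone (seq b) image
    seq⇒image false x y d with to-mono {x} {y} (inj₁ d)
    ... | inj₁ l       = inj₁ l
    ... | inj₂ (e , _) = inj₂ e
    seq⇒image true x y (m , a , l) with to-mono {y} {x} (inj₁ (m , (λ i p → A.Eq.sym (a i p)) , l))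
    ... | inj₁ (m , a , l) = inj₁ (m , (λ i p → A.Eq.sym (a i p)) , l)
    ... | inj₂ (e , _)     = inj₂ (≋-sym e)

    image⇒seq : WeaklyMonotone image (seq b)
    image⇒seq false x y d with cancel {x} {y} (inj₁ d)
    ... | inj₁ l       = inj₁ l
    ... | inj₂ (e , _) = inj₂ e
    image⇒seq true x y (m , a , l) with cancel {y} {x} (inj₁ (m , (λ i p → A.Eq.sym (a i p)) , l))
    ... | inj₁ (m , a , l) = inj₁ (m , (λ i p → A.Eq.sym (a i p)) , l)
    ... | inj₂ (e , _)     = inj₂ (≋-sym e)

    default : ∀ d → StrictTotalOrder.Carrier (Fibre d)
    default d = _ , 0 , λ _ _ → refl

    seq-covering : Covering (seq b)
    seq-covering w alt = include b alt (default b) , λ _ → A.Eq.refl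

    image-covering : Covering image
    image-covering w alt = let y = include c alt (default c) in from y , proj₁ (to-from y)

    -- `forth` keeps images over w, so only their tails can be compared; `back` places preimages
    -- over w and gives surjectivity.
    fibre-≅ : ∀ {w} → Alternating w → (∀ x → seq b x ≋ w → image x ≋ w) →
              (∀ x → image x ≋ w → seq b x ≋ w) → Fibre b ≅ Fibre c
    fibre-≅ {w} alt forth back = mono⇒≅ {Fibre b} {Fibre c} f
      (λ {x} {y} e → proj₂ (to-cong {lift x} {lift y} ((λ _ → A.Eq.refl) , e)))
      (λ {x} {y} → f-mono x y)
      f-surjective
      where
      lift : StrictTotalOrder.Carrier (Fibre b) → Z.Carrier b
      lift = include b alt

      in-fibre : ∀ x → image (lift x) ≋ w
      in-fibre x = forth (lift x) λ _ → A.Eq.refl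

      f : StrictTotalOrder.Carrier (Fibre b) → StrictTotalOrder.Carrier (Fibre c)
      f x = project c alt (to (lift x)) (in-fibre x)

      f-mono : ∀ x y → proj₁ x ≺ proj₁ y → proj₁ (f x) ≺ proj₁ (f y)
      f-mono x y l with to-mono {lift x} {lift y} (inj₂ ((λ _ → A.Eq.refl) , l))
      ... | inj₂ (_ , k) = k
      ... | inj₁ (m , _ , k) =
        ⊥-elim (A.irrefl (A.Eq.trans (in-fibre x m) (A.Eq.sym (in-fibre y m))) k)

      f-surjective : ∀ y → ∃ λ x → proj₁ (f x) ≗ proj₁ y
      f-surjective y = project b alt z e , λ n →
        trans (proj₂ (to-cong {lift (project b alt z e)} {z} (≋-sym e , λ _ → refl)) n)
              (proj₂ (to-from (include c alt y)) n)
        where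
        z = from (include c alt y)
        e = back z (proj₁ (to-from (include c alt y)))

    -- Isomorphic fibres have eventually equal target sequences, and a single index N in the common
    -- range determines the Boolean.
    Z-injective : b ≡ c
    Z-injective =
      let w , alt , forth , back = BackAndForth.fixed-point {p = seq b} {image}
                                     seq⇒image image⇒seq seq-covering image-covering
          N , e = tails-injective (fibre-≅ alt forth back)
      in xor-injective (parity N) (bit-injective (e N ℕₚ.≤-refl))

  Z-false≇Z-true : ¬ Z false ≅ Z true
  Z-false≇Z-true φ = contradiction (Z-injective {false} {true} φ) λ ()

mainTheorem1 : (∀ {ℓ} → ExcludedMiddle ℓ) →
    (∀ {a b} → Extensionality a b) →
    ((ω₁ : LinearOrder) → IsFirstUncountableOrdinal ω₁ →
    let A = ω₁ * ⊕ ω₁ in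
    ∃ λ (X : LinearOrder) → ∃ λ (Y : LinearOrder) →
    ¬ (X ≅ Y)
    × X ≅ A ⊗ Y
    × X ≅ Y ⊗ ω
    × Y ≅ A ⊗ X
    × Y ≅ X ⊗ ω)
    × (∃ λ (X : LinearOrder) → ∃ λ (Y : LinearOrder) →
    ¬ (X ≅ Y)
    × LeftDivisor X Y × RightDivisor X Y
    × LeftDivisor Y X × RightDivisor Y X)
mainTheorem1 em _ = construct ,
  -- The divisor statement mentions no ω₁, so one is supplied. The cofactor is ω for left divisors
  -- and A for right divisors.
  (let Ω , isΩ = ω₁-exists em
       X , Y , X≇Y , X≅AY , X≅Yω , Y≅AX , Y≅Xω = construct Ω isΩ
   in X , Y , X≇Y , (ω , Y≅Xω) , (Ω * ⊕ Ω , Y≅AX) , (ω , X≅Yω) , (Ω * ⊕ Ω , X≅AY))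
  where
  construct : (Ω : LinearOrder) → IsFirstUncountableOrdinal Ω →
    let A = Ω * ⊕ Ω in ∃ λ X → ∃ λ Y →
    ¬ (X ≅ Y) × X ≅ A ⊗ Y × X ≅ Y ⊗ ω × Y ≅ A ⊗ X × Y ≅ X ⊗ ω
  construct Ω isΩ = Z false , Z true , Z-false≇Z-true ,
                    Z-⊗ˡ false , Z-⊗ω false , Z-⊗ˡ true , Z-⊗ω true
    where open Divisors em Ω isΩ
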